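{- Let $G$ be an interlacement graph of an Euler system of a 4-regular graph $F$, and let $k$ be a positive integer. If $F$ has a $k$-circuit (a circuit of size $k$), then $G$ has a transverse circuit of size $\leq k$.
   Context: All graphs are finite. A 4-regular graph may have loops and multiple edges. A circuit in a graph is a closed walk of positive length using no edge (half-edge) more than once; vertices may repeat. Circuits differing only in starting point or orientation are identified. The size of a circuit is its number of edges. An Euler system $C$ of a 4-regular graph $F$ is a set containing precisely one Euler circuit of each connected component of $F$. The interlacement graph $\mathcal{I}(C)$ is the simple graph with vertex set $V(F)$ in which $v\neq w$ are adjacent iff they appear in the cyclic order $v\ldots w\ldots v\ldots w$ on one of the circuits of $C$. For a simple graph $G$ with adjacency matrix $A$ over $GF(2)$, let $IAS(G)=(I\ \ A\ \ I+A)$ over $GF(2)$, $I$ the $V(G)\times V(G)$ identity matrix. The $v$ columns of $I$, $A$, $I+A$ are labelled $\phi_G(v),\chi_G(v),\psi_G(v)$; $W(G)$ is the set of these $3|V(G)|$ labels, and $M[IAS(G)]$ is the binary matroid on $W(G)$ represented by $IAS(G)$. The vertex triple of $v$ is $\{\phi_G(v),\chi_G(v),\psi_G(v)\}$. A transversal of $W(G)$ is a subset containing exactly one element of each vertex triple. A transverse circuit of $G$ is a matroid circuit of $M[IAS(G)]$ contained in a transversal. -}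

module Defs where

open import Data.Bool.Base using (Bool; true; false; not; _∧_; _xor_)
open import Data.Bool.Properties using (xor-∧-commutativeRing)
open import Data.Fin.Base using (Fin; _↑ˡ_; _↑ʳ_)
open import Data.Fin.Properties using (_≟_; any?)
open import Data.Fin.Subset as Subset using (Subset; _∪_; _∩_; ⁅_⁆)
open import Data.List.Base using (List; []; _∷_; _∷ʳ_; map; length)
open import Data.List.Membership.Propositional using (_∈_)
open import Data.List.Relation.Binary.Sublist.Propositional using (_⊆_)
import Data.List.Relation.Binary.Sublist.DecPropositional as DecSublist
open import Data.List.Relation.Unary.Linked using (Linked)
open import Data.List.Relation.Unary.Unique.Propositional using (Unique)
open import Data.Nat.Base using (ℕ; _+_)
open import Data.Product using (∃; ∃!; _×_; _,_; proj₁)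
open import Data.Sum.Base using (_⊎_; swap)
open import Data.Vec.Functional using (_++_)
open import Function.Base using (_∘_)
open import Function.Bundles using (_⇔_; _↔_)
open import Level using (0ℓ)
open import Relation.Binary.Construct.Closure.ReflexiveTransitive using (Star)
open import Relation.Binary.Core using (Rel)
open import Relation.Binary.Definitions using (Decidable; Symmetric; Irreflexive)
open import Relation.Binary.PropositionalEquality.Core using (_≡_; _≢_; refl; sym)
open import Relation.Nullary.Decidable using (does; ¬?; _×-dec_; _⊎-dec_)
open import Relation.Nullary.Negation.Core using (¬_)

open import Algebra.Bundles using (CommutativeRing)
open import Algebra.Properties.Monoid.Sum
  (CommutativeRing.+-monoid xor-∧-commutativeRing) using (sum)

-- Every edge e consists of the two half-edges (e , false) and (e , true);
-- a loop has both of them at the same vertex.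
record FourRegularGraph : Set where
  field
    #vertices : ℕ
    #edges    : ℕ

  Vertex   = Fin #vertices
  Edge     = Fin #edges
  HalfEdge = Edge × Bool

  edge : HalfEdge → Edge
  edge = proj₁

  opposite : HalfEdge → HalfEdge
  opposite (e , b) = e , not b

  field
    vertexOf : HalfEdge → Vertex
    regular  : ∀ v → Fin 4 ↔ ∃ λ h → vertexOf h ≡ v

  -- A half-edge h also stands for the traversal of its edge that starts at h
  -- and ends at opposite h.
  source target : HalfEdge → Vertex
  source = vertexOf
  target = vertexOf ∘ opposite

  _⟶_ : Rel Vertex 0ℓ
  v ⟶ w = ∃ λ h → source h ≡ v × target h ≡ w

  Connected : Rel Vertex 0ℓ
  Connected = Star _⟶_

module _ (F : FourRegularGraph) where
  open FourRegularGraph F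

  record Circuit : Set where
    field
      first  : HalfEdge
      rest   : List HalfEdge

    steps : List HalfEdge
    steps = first ∷ rest

    field
      closed : Linked (λ h h′ → target h ≡ source h′) (steps ∷ʳ first)
      simple : Unique (map edge steps)

    vertices : List Vertex
    vertices = map source steps

    size : ℕ
    size = length steps

  open Circuit

  EulerCircuitOfComponent : Vertex → Circuit → Set
  EulerCircuitOfComponent v c =
    ∀ h → edge h ∈ map edge (steps c) ⇔ Connected v (vertexOf h)

  -- Circuits are to be identified up to starting point and orientation; an
  -- Euler system is given by one representative for each of its members.
  record EulerSystem : Set where
    field
      #circuits : ℕ
      circuit   : Fin #circuits → Circuit
      eulerian  : ∀ i → ∃ λ v → EulerCircuitOfComponent v (circuit i)
      unique    : ∀ v → ∃! _≡_ λ i → EulerCircuitOfComponent v (circuit i)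

record SimpleGraph (n : ℕ) : Set₁ where
  field
    Adj        : Rel (Fin n) 0ℓ
    adj?       : Decidable Adj
    adj-sym    : Symmetric Adj
    adj-irrefl : Irreflexive _≡_ Adj

module _ {F : FourRegularGraph} where
  open FourRegularGraph F
  open DecSublist (_≟_ {#vertices}) using (_⊆?_)

  -- The vertices of a circuit are listed from an arbitrary starting point, so
  -- the cyclic pattern v … w … v … w may be read off starting from v or from w.
  CyclicallyAlternate : Circuit F → Rel Vertex 0ℓ
  CyclicallyAlternate c v w =
      (v ∷ w ∷ v ∷ w ∷ []) ⊆ Circuit.vertices c
    ⊎ (w ∷ v ∷ w ∷ v ∷ []) ⊆ Circuit.vertices c

  module _ (C : EulerSystem F) where
    open EulerSystem C

    Interlaced : Rel Vertex 0ℓ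
    Interlaced v w = v ≢ w × ∃ λ i → CyclicallyAlternate (circuit i) v w

    interlaced? : Decidable Interlaced
    interlaced? v w = ¬? (v ≟ w) ×-dec any? λ i →
      (_ ⊆? Circuit.vertices (circuit i)) ⊎-dec (_ ⊆? Circuit.vertices (circuit i))

    interlacementGraph : SimpleGraph #vertices
    interlacementGraph = record
      { Adj        = Interlaced
      ; adj?       = interlaced?
      ; adj-sym    = λ (v≢w , i , alt) → (v≢w ∘ sym) , i , swap alt
      ; adj-irrefl = λ v≡w (v≢w , _) → v≢w v≡w
      }

-- GF(2) is Bool with addition _xor_ and multiplication _∧_.
Matrix : ℕ → ℕ → Set
Matrix m n = Fin m → Fin n → Bool

module _ {m n : ℕ} (M : Matrix m n) where

  -- Linear independence of the columns in S: a linear combination is a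
  -- coefficient vector on all columns that vanishes outside S.
  Independent : Subset n → Set
  Independent S = (a : Fin n → Bool) →
    (∀ j → j Subset.∉ S → a j ≡ false) →
    (∀ i → sum (λ j → a j ∧ M i j) ≡ false) →
    ∀ j → a j ≡ false

  MatroidCircuit : Subset n → Set
  MatroidCircuit S = ¬ Independent S × (∀ T → T Subset.⊂ S → Independent T)

module _ {n : ℕ} (G : SimpleGraph n) where
  open SimpleGraph G

  identityMatrix adjacencyMatrix : Matrix n n
  identityMatrix  v w = does (v ≟ w)
  adjacencyMatrix v w = does (adj? v w)

  IAS : Matrix n (n + (n + n))
  IAS v = identityMatrix v ++ adjacencyMatrix v
       ++ λ w → identityMatrix v w xor adjacencyMatrix v w

module _ {n : ℕ} where

  -- W(G) is encoded as the set Fin (n + (n + n)) of column indices of IAS(G).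
  φ χ ψ : Fin n → Fin (n + (n + n))
  φ v = v ↑ˡ (n + n)
  χ v = n ↑ʳ (v ↑ˡ n)
  ψ v = n ↑ʳ (n ↑ʳ v)

  vertexTriple : Fin n → Subset (n + (n + n))
  vertexTriple v = ⁅ φ v ⁆ ∪ ⁅ χ v ⁆ ∪ ⁅ ψ v ⁆

  Transversal : Subset (n + (n + n)) → Set
  Transversal T = ∀ v → ∃! _≡_ λ x → x Subset.∈ T ∩ vertexTriple v

TransverseCircuit : {n : ℕ} → SimpleGraph n → Subset (n + (n + n)) → Set
TransverseCircuit {n} G S =
  MatroidCircuit (IAS G) S × ∃ λ T → Transversal {n} T × S Subset.⊆ T

{-# OPTIONS --safe #-}
module Submission where

-- Fix an Euler system. For a vertex w, the two passes of its Euler circuit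
-- through w split the edges of the component into two sides. For two distinct
-- half-edges h, k at a vertex v, the vector recording for which w the edges of
-- h and k lie on different sides is one of the three columns of v: φ v if C
-- itself passes from h to k, and χ v or ψ v otherwise. Summing these vectors
-- along a circuit γ telescopes to zero. After shortening γ so that it repeats
-- no vertex, the columns belong to distinct vertices, so they form a nonempty
-- dependent subset of a transversal, which contains a matroid circuit.

open import Defs
open import Algebra.Bundles using (CommutativeRing)
open import Axiom.UniquenessOfIdentityProofs using (module Decidable⇒UIP)
open import Data.Bool.Base using (Bool; true; false; not; _∧_; _xor_; if_then_else_)
import Data.Bool.Properties as Bool
open import Data.Bool.Properties
  using (xor-∧-commutativeRing; xor-same; xor-comm; xor-assoc; xor-identityʳ; ∧-distribʳ-xor;
         not-¬; ¬-not; not-involutive)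
open import Algebra.Properties.CommutativeMonoid.Sum
  (CommutativeRing.+-commutativeMonoid xor-∧-commutativeRing) using (∑-distrib-+)
open import Algebra.Properties.CommutativeSemigroup
  (CommutativeRing.+-commutativeSemigroup xor-∧-commutativeRing) using (interchange)
open import Algebra.Properties.Monoid.Sum
  (CommutativeRing.+-monoid xor-∧-commutativeRing) using (sum; sum-cong-≗)
open import Data.Empty using (⊥-elim)
open import Data.Fin.Base using (Fin; zero; suc; splitAt; _↑ˡ_; _↑ʳ_)
open import Data.Fin.Properties
  using (_≟_; all?; splitAt-↑ˡ; splitAt-↑ʳ; splitAt⁻¹-↑ˡ; splitAt⁻¹-↑ʳ)
open import Data.Fin.Subset as Subset using (Subset; ∣_∣; ⁅_⁆; _∪_; ⋃; Nonempty; inside; outside)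
open import Data.Fin.Subset.Induction using (⊂-wellFounded)
open import Data.Fin.Subset.Properties
  using (∪-identityˡ; ∣⊥∣≡0; p⊆q⇒∣p∣≤∣q∣; x∈⁅x⁆; x∈⁅y⁆⇒x≡y; x∈p∪q⁺; x∈p∪q⁻; x∈p∩q⁺; x∈p∩q⁻;
         anySubset?; nonempty?; _⊂?_; ⊆-trans; ⊆-refl)
open import Data.List.Base
  using (List; []; _∷_; [_]; _++_; _∷ʳ_; map; filter; foldr; length; zip; allFin)
open import Data.List.Membership.DecPropositional using (_∈?_)
open import Data.List.Membership.Propositional using (_∈_; _∉_)
open import Data.List.Membership.Propositional.Properties
  using (∈-map⁺; ∈-map⁻; ∈-++⁺ˡ; ∈-++⁺ʳ; ∈-∃++; ∈-filter⁺; ∈-filter⁻; ∈-insert; ∈-allFin)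
open import Data.List.Membership.Propositional.Properties.WithK using (unique∧set⇒bag)
open import Data.List.Properties
  using (filter-++; filter-accept; filter-reject; filter-some; length-++; length-map; map-++; map-∘;
         ++-assoc; ∷ʳ-++)
open import Data.List.Relation.Binary.BagAndSetEquality using (∼bag⇒↭)
open import Data.List.Relation.Binary.Permutation.Propositional using (_↭_; ↭-sym)
open import Data.List.Relation.Binary.Permutation.Propositional.Properties
  using (↭-length; filter-↭; ∷↭∷ʳ; map⁺; ∈-resp-↭)
open import Data.List.Relation.Binary.Sublist.Propositional as Sublist
  using (_⊆_; _∷_; from∈) renaming (_∷ʳ_ to _∷ˢ_)
open import Data.List.Relation.Binary.Sublist.Propositional.Properties using (++⁺)
open import Data.List.Relation.Unary.All as All using ([]; _∷_)
import Data.List.Relation.Unary.All.Properties as All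
open import Data.List.Relation.Unary.AllPairs using ([]; _∷_)
open import Data.List.Relation.Unary.Any using (here; there)
open import Data.List.Relation.Unary.Linked using (Linked; []; [-]; _∷_; tail)
open import Data.List.Relation.Unary.Unique.Propositional using (Unique)
import Data.List.Relation.Unary.Unique.Propositional.Properties as Unique
open import Data.Nat.Base using (ℕ; zero; suc; _+_; _∸_; _≤_; _<_; z≤n; s≤s; NonZero)
import Data.Nat.Properties as ℕ
open import Data.Product.Base using (∃; ∃₂; _×_; _,_; proj₁; proj₂)
open import Data.Product.Properties using (≡-dec)
open import Data.Sum.Base using (_⊎_; inj₁; inj₂)
open import Data.Vec.Base using (tabulate; lookup; []; _∷_)
open import Data.Vec.Functional.Properties using (lookup-++ˡ; lookup-++ʳ)
open import Data.Vec.Properties using (lookup∘tabulate; []=⇒lookup; lookup⇒[]=)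
open import Function.Base using (_∘_)
open import Function.Bundles using (_⇔_; mk⇔; Inverse; Injection; Equivalence)
open import Function.Properties.Inverse using (↔⇒↣)
open import Induction.WellFounded using (Acc; acc)
open import Relation.Binary.Construct.Closure.ReflexiveTransitive using (ε; _◅_; _◅◅_; reverse)
open import Relation.Binary.PropositionalEquality
  using (_≡_; _≢_; refl; sym; trans; cong; cong₂; subst; module ≡-Reasoning)
open import Relation.Nullary.Decidable
  using (Dec; yes; no; does; _×-dec_; dec-true; dec-false; does-⇔)
open import Relation.Nullary.Negation using (¬_; contradiction)

-- Three columns per vertex suffice because the four half-edges at `v` are coded by pass and
-- direction. The two leaving edges differ by the `ψ` column: the visits between the two departures
-- give the adjacency entries, and the second departure itself gives the diagonal entry. Exchanging
-- a leaving edge for the entering edge of the same pass adds the identity column. Every other pair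
-- is a sum of these. The obstacle is that circuits are lists with a starting point, while passes
-- and interlacement are cyclic. Parities of visits bridge the two: each vertex of an Euler circuit
-- is visited exactly twice, so its total parity is even and the cut between last and first step is
-- invisible. Shortening matters because a repeated vertex could contribute two different columns,
-- which fit in no transversal, or the same column twice, which cancels.

-- Zero sums of columns over GF(2) and matroid circuits

xorSum : List Bool → Bool
xorSum = foldr _xor_ false

sum-false : ∀ n → sum {n} (λ _ → false) ≡ false
sum-false zero    = refl
sum-false (suc n) = sum-false n

sum-select : ∀ {n} (x : Fin n) (f : Fin n → Bool) → sum (λ j → does (j ≟ x) ∧ f j) ≡ f x
sum-select {suc n} zero    f = trans (cong (f zero xor_) (sum-false n)) (xor-identityʳ _)
sum-select {suc n} (suc x) f = sum-select x (f ∘ suc)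

-- Turns a list of columns into a coefficient vector of the kind that `Independent` quantifies over.
-- Counting mod 2 keeps `sum-multiplicity` valid for lists with repetitions.
multiplicity : ∀ {n} → List (Fin n) → Fin n → Bool
multiplicity xs j = xorSum (map (λ x → does (j ≟ x)) xs)

sum-multiplicity : ∀ {n} (f : Fin n → Bool) xs →
                   sum (λ j → multiplicity xs j ∧ f j) ≡ xorSum (map f xs)
sum-multiplicity {n} f []       = sum-false n
sum-multiplicity f (x ∷ xs) = begin
  sum (λ j → (does (j ≟ x) xor multiplicity xs j) ∧ f j)
    ≡⟨ sum-cong-≗ (λ j → ∧-distribʳ-xor (f j) (does (j ≟ x)) (multiplicity xs j)) ⟩
  sum (λ j → (does (j ≟ x) ∧ f j) xor (multiplicity xs j ∧ f j))
    ≡⟨ ∑-distrib-+ (λ j → does (j ≟ x) ∧ f j) (λ j → multiplicity xs j ∧ f j) ⟩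
  sum (λ j → does (j ≟ x) ∧ f j) xor sum (λ j → multiplicity xs j ∧ f j)
    ≡⟨ cong₂ _xor_ (sum-select x f) (sum-multiplicity f xs) ⟩
  f x xor xorSum (map f xs) ∎
  where open ≡-Reasoning

multiplicity-∉ : ∀ {n} {j : Fin n} xs → j ∉ xs → multiplicity xs j ≡ false
multiplicity-∉ []       _    = refl
multiplicity-∉ {j = j} (x ∷ xs) j∉xs
  rewrite dec-false (j ≟ x) (j∉xs ∘ here) = multiplicity-∉ xs (j∉xs ∘ there)

multiplicity-∈ : ∀ {n} {j : Fin n} xs → multiplicity xs j ≡ true → j ∈ xs
multiplicity-∈ {j = j} (x ∷ xs) eq with j ≟ x
... | yes j≡x = here j≡x
... | no  _   = there (multiplicity-∈ xs eq)

multiplicity-head : ∀ {n} {x : Fin n} {xs} → x ∉ xs → multiplicity (x ∷ xs) x ≡ true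
multiplicity-head {x = x} {xs} x∉xs
  rewrite dec-true (x ≟ x) refl | multiplicity-∉ xs x∉xs = refl

∣⁅x⁆∪p∣≤1+∣p∣ : ∀ {n} (x : Fin n) (p : Subset n) → ∣ ⁅ x ⁆ ∪ p ∣ ≤ suc ∣ p ∣
∣⁅x⁆∪p∣≤1+∣p∣ zero    (s ∷ p) rewrite ∪-identityˡ p = s≤s (tail-≤ s)
  where
  tail-≤ : ∀ s → ∣ p ∣ ≤ ∣ s ∷ p ∣
  tail-≤ inside  = ℕ.n≤1+n _
  tail-≤ outside = ℕ.≤-refl
∣⁅x⁆∪p∣≤1+∣p∣ (suc x) (inside  ∷ p) = s≤s (∣⁅x⁆∪p∣≤1+∣p∣ x p)
∣⁅x⁆∪p∣≤1+∣p∣ (suc x) (outside ∷ p) = ∣⁅x⁆∪p∣≤1+∣p∣ x p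

∣⋃⁅xs⁆∣≤length : ∀ {n} (xs : List (Fin n)) → ∣ ⋃ (map ⁅_⁆ xs) ∣ ≤ length xs
∣⋃⁅xs⁆∣≤length {n} []   = ℕ.≤-reflexive (∣⊥∣≡0 n)
∣⋃⁅xs⁆∣≤length (x ∷ xs) =
  ℕ.≤-trans (∣⁅x⁆∪p∣≤1+∣p∣ x (⋃ (map ⁅_⁆ xs))) (s≤s (∣⋃⁅xs⁆∣≤length xs))

∈⇒∈⋃⁅⁆ : ∀ {n} {j : Fin n} {xs} → j ∈ xs → j Subset.∈ ⋃ (map ⁅_⁆ xs)
∈⇒∈⋃⁅⁆ {j = j} (here refl) = x∈p∪q⁺ (inj₁ (x∈⁅x⁆ j))
∈⇒∈⋃⁅⁆         (there j∈)  = x∈p∪q⁺ (inj₂ (∈⇒∈⋃⁅⁆ j∈))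

-- The subsets of columns with sum zero are the cycles of the matroid; its
-- circuits are the minimal nonempty ones.
module _ {m n} (M : Matrix m n) where

  Cycle : Subset n → Set
  Cycle S = Nonempty S × (∀ i → sum (λ j → lookup S j ∧ M i j) ≡ false)

  private
    smaller? : ∀ S → Dec (∃ λ T → T Subset.⊂ S × Cycle T)
    smaller? S = anySubset? λ T → (T ⊂? S) ×-dec
      (nonempty? T ×-dec all? λ i → sum (λ j → lookup T j ∧ M i j) Bool.≟ false)

    support-cycle : ∀ (a : Fin n → Bool) {j} → a j ≡ true →
                    (∀ i → sum (λ j → a j ∧ M i j) ≡ false) → Cycle (tabulate a)
    support-cycle a {j} aj≡true zeroSum =
        (j , lookup⇒[]= j _ (trans (lookup∘tabulate a j) aj≡true))
      , λ i → trans (sum-cong-≗ λ j → cong (_∧ M i j) (lookup∘tabulate a j)) (zeroSum i)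

    minimal⇒circuit : ∀ {S} → Cycle S → ¬ (∃ λ T → T Subset.⊂ S × Cycle T) →
                      MatroidCircuit M S
    minimal⇒circuit {S} ((j , j∈S) , zeroSum) minimal = dependent , independent
      where
      dependent : ¬ Independent M S
      -- The characteristic vector of `S` is a nontrivial relation supported on `S`.
      dependent indep with () ← trans (sym ([]=⇒lookup j∈S))
        (indep (lookup S) (λ k k∉S → ¬-not (k∉S ∘ lookup⇒[]= k S)) zeroSum j)
      independent : ∀ T → T Subset.⊂ S → Independent M T
      independent T (T⊆S , x , x∈S , x∉T) a vanishes zeroSum′ j with a j in aj
      ... | false = refl
      -- A nontrivial relation supported on `T` has as its support a cycle inside `T`, hence
      -- properly inside `S`.
      ... | true  = ⊥-elim (minimal
        ( tabulate a , ((λ {k} → T⊆S ∘ support⊆T) , x , x∈S , x∉T ∘ support⊆T)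
        , support-cycle a aj zeroSum′))
        where
        support⊆T : ∀ {k} → k Subset.∈ tabulate a → k Subset.∈ T
        support⊆T {k} k∈ with lookup T k in Tk
        ... | true  = lookup⇒[]= k T Tk
        ... | false with () ← trans (sym (trans (sym (lookup∘tabulate a k)) ([]=⇒lookup k∈)))
                                    (vanishes k λ k∈T → not-¬ Tk ([]=⇒lookup k∈T))

  -- Descent along strict inclusion. Whether a smaller cycle exists is decided by searching all
  -- subsets, so the minimal one is found constructively.
  cycle⊇circuit : ∀ {S} → Cycle S → ∃ λ T → T Subset.⊆ S × MatroidCircuit M T
  cycle⊇circuit {S} = go (⊂-wellFounded S)
    where
    go : ∀ {S} → Acc Subset._⊂_ S → Cycle S → ∃ λ T → T Subset.⊆ S × MatroidCircuit M T
    go {S} (acc rec) cyc with smaller? S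
    ... | no minimal = S , ⊆-refl , minimal⇒circuit cyc minimal
    ... | yes (T , T⊂S , cycT) with U , U⊆T , circ ← go (rec T⊂S) cycT =
      U , ⊆-trans U⊆T (proj₁ T⊂S) , circ

  -- Without repetitions the column `x` has coefficient 1, so the zero sum has nonempty support and
  -- is a cycle.
  zeroSum⇒circuit : ∀ x xs → Unique (x ∷ xs) →
                    (∀ i → xorSum (map (M i) (x ∷ xs)) ≡ false) →
                    ∃ λ S → MatroidCircuit M S × (∀ {j} → j Subset.∈ S → j ∈ x ∷ xs)
                          × ∣ S ∣ ≤ length (x ∷ xs)
  zeroSum⇒circuit x xs (x≢xs ∷ _) zeroSum
    with S , S⊆supp , circ ← cycle⊇circuit (support-cycle (multiplicity (x ∷ xs)) {x}
           (multiplicity-head λ x∈xs → All.lookup x≢xs x∈xs refl)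
           (λ i → trans (sum-multiplicity (M i) (x ∷ xs)) (zeroSum i))) =
    S , circ , S⊆xs , ℕ.≤-trans (p⊆q⇒∣p∣≤∣q∣ (∈⇒∈⋃⁅⁆ ∘ S⊆xs)) (∣⋃⁅xs⁆∣≤length (x ∷ xs))
    where
    S⊆xs : ∀ {j} → j Subset.∈ S → j ∈ x ∷ xs
    S⊆xs {j} j∈S = multiplicity-∈ (x ∷ xs)
      (trans (sym (lookup∘tabulate (multiplicity (x ∷ xs)) j)) ([]=⇒lookup (S⊆supp j∈S)))

-- Vertex triples and transversals

module _ {n : ℕ} where

  -- Turns membership in `vertexTriple v` into the equation `owner j ≡ v`, so that meeting each
  -- triple at most once becomes distinctness of owners.
  owner : Fin (n + (n + n)) → Fin n
  owner j with splitAt n j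
  ... | inj₁ v = v
  ... | inj₂ k with splitAt n k
  ...   | inj₁ v = v
  ...   | inj₂ v = v

  owner-φ : ∀ v → owner (φ v) ≡ v
  owner-φ v rewrite splitAt-↑ˡ n v (n + n) = refl

  owner-χ : ∀ v → owner (χ v) ≡ v
  owner-χ v rewrite splitAt-↑ʳ n (n + n) (v ↑ˡ n) | splitAt-↑ˡ n v n = refl

  owner-ψ : ∀ v → owner (ψ v) ≡ v
  owner-ψ v rewrite splitAt-↑ʳ n (n + n) (n ↑ʳ v) | splitAt-↑ʳ n n v = refl

  ∈triple-owner : ∀ j → j Subset.∈ vertexTriple (owner j)
  ∈triple-owner j with splitAt n j in eq
  ... | inj₁ v with refl ← splitAt⁻¹-↑ˡ {n} {n + n} {j} eq = x∈p∪q⁺ (inj₁ (x∈⁅x⁆ _))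
  ... | inj₂ k with splitAt n k in eq′
  ...   | inj₁ v with refl ← splitAt⁻¹-↑ʳ {n} {n + n} {j} eq | refl ← splitAt⁻¹-↑ˡ {n} {n} {k} eq′ =
    x∈p∪q⁺ (inj₂ (x∈p∪q⁺ (inj₁ (x∈⁅x⁆ _))))
  ...   | inj₂ v with refl ← splitAt⁻¹-↑ʳ {n} {n + n} {j} eq | refl ← splitAt⁻¹-↑ʳ {n} {n} {k} eq′ =
    x∈p∪q⁺ (inj₂ (x∈p∪q⁺ (inj₂ (x∈⁅x⁆ _))))

  ∈triple⇒owner : ∀ {j v} → j Subset.∈ vertexTriple v → owner j ≡ v
  ∈triple⇒owner {j} {v} j∈ with x∈p∪q⁻ ⁅ φ v ⁆ _ j∈
  ... | inj₁ j∈φ rewrite x∈⁅y⁆⇒x≡y _ j∈φ = owner-φ v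
  ... | inj₂ j∈χψ with x∈p∪q⁻ ⁅ χ v ⁆ _ j∈χψ
  ...   | inj₁ j∈χ rewrite x∈⁅y⁆⇒x≡y _ j∈χ = owner-χ v
  ...   | inj₂ j∈ψ rewrite x∈⁅y⁆⇒x≡y _ j∈ψ = owner-ψ v

  private
    choose : List (Fin (n + (n + n))) → Fin n → Fin (n + (n + n))
    -- An arbitrary default for the vertices that own no listed column.
    choose []       v = φ v
    choose (x ∷ xs) v with owner x ≟ v
    ... | yes _ = x
    ... | no  _ = choose xs v

    owner-choose : ∀ xs v → owner (choose xs v) ≡ v
    owner-choose []       v = owner-φ v
    owner-choose (x ∷ xs) v with owner x ≟ v
    ... | yes eq = eq
    ... | no  _  = owner-choose xs v

    choose-owner : ∀ {xs j} → Unique (map owner xs) → j ∈ xs → choose xs (owner j) ≡ j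
    choose-owner {x ∷ xs} {j} (x≢ ∷ uniq) j∈ with owner x ≟ owner j | j∈
    ... | yes _  | here refl  = refl
    ... | yes eq | there j∈xs = contradiction eq (All.lookup x≢ (∈-map⁺ owner j∈xs))
    ... | no neq | here refl  = contradiction refl neq
    ... | no _   | there j∈xs = choose-owner uniq j∈xs

  -- Distinct owners make each listed column the one chosen for its owner. The transversal consists
  -- of the fixed points of choosing after `owner`; by `owner-choose` these are exactly the chosen
  -- columns.
  transversal⊇ : ∀ xs → Unique (map owner xs) →
                 ∃ λ T → Transversal {n} T × (∀ {j} → j ∈ xs → j Subset.∈ T)
  transversal⊇ xs uniq =
    T , (λ v → choose xs v
             , x∈p∩q⁺ ( ∈T (cong (choose xs) (owner-choose xs v))
                      , subst (λ u → choose xs v Subset.∈ vertexTriple u) (owner-choose xs v)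
                              (∈triple-owner (choose xs v)))
             , λ {y} y∈ → let y∈T , y∈triple = x∈p∩q⁻ T _ y∈ in
                 trans (cong (choose xs) (sym (∈triple⇒owner y∈triple))) (sym (T∈ y∈T)))
      , λ j∈xs → ∈T (choose-owner uniq j∈xs)
    where
    T : Subset (n + (n + n))
    T = tabulate λ j → does (j ≟ choose xs (owner j))
    ∈T : ∀ {j} → choose xs (owner j) ≡ j → j Subset.∈ T
    ∈T {j} eq = lookup⇒[]= j T (trans (lookup∘tabulate _ j) (dec-true (j ≟ _) (sym eq)))
    T∈ : ∀ {j} → j Subset.∈ T → j ≡ choose xs (owner j)
    T∈ {j} j∈T with j ≟ choose xs (owner j)
                  | trans (sym (lookup∘tabulate (λ j → does (j ≟ choose xs (owner j))) j))
                          ([]=⇒lookup j∈T)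
    ... | yes eq | _ = eq

-- Lists and parities of occurrences

xor-cancelˡ : ∀ p q → p xor (p xor q) ≡ q
xor-cancelˡ p q = trans (sym (xor-assoc p p q)) (cong (_xor q) (xor-same p))

xor-cancel : ∀ p q → (p xor q) xor p ≡ q
xor-cancel p q = trans (xor-comm (p xor q) p) (xor-cancelˡ p q)

-- The zip lists the consecutive pairs of `x ∷ xs ∷ʳ y`. For the transitions of a circuit, `y` is
-- `x` again and the sum vanishes.
xorSum-telescope : ∀ {A : Set} (f : A → Bool) x xs y →
  xorSum (map (λ (s , t) → f s xor f t) (zip (x ∷ xs) (xs ∷ʳ y))) ≡ f x xor f y
xorSum-telescope f x []       y = xor-identityʳ _
xorSum-telescope f x (z ∷ xs) y = begin
  (f x xor f z) xor xorSum (map (λ (s , t) → f s xor f t) (zip (z ∷ xs) (xs ∷ʳ y)))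
    ≡⟨ cong ((f x xor f z) xor_) (xorSum-telescope f z xs y) ⟩
  (f x xor f z) xor (f z xor f y)  ≡⟨ xor-assoc (f x) (f z) _ ⟩
  f x xor (f z xor (f z xor f y))  ≡⟨ cong (f x xor_) (xor-cancelˡ (f z) (f y)) ⟩
  f x xor f y ∎
  where open ≡-Reasoning

odd : ℕ → Bool
odd zero    = false
odd (suc n) = not (odd n)

odd-+ : ∀ m n → odd (m + n) ≡ odd m xor odd n
odd-+ zero    n = refl
odd-+ (suc m) n rewrite odd-+ m n with odd m | odd n
... | true  | true  = refl
... | true  | false = refl
... | false | _     = refl

count : ∀ {n} → Fin n → List (Fin n) → ℕ
count v xs = length (filter (v ≟_) xs)

module _ {n} {v : Fin n} where

  count-++ : ∀ xs ys → count v (xs ++ ys) ≡ count v xs + count v ys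
  count-++ xs ys = trans (cong length (filter-++ (v ≟_) xs ys)) (length-++ (filter (v ≟_) xs))

  count-≡ : ∀ xs → count v (v ∷ xs) ≡ suc (count v xs)
  count-≡ xs = cong length (filter-accept (v ≟_) {xs = xs} refl)

  count-≢ : ∀ {u} xs → v ≢ u → count v (u ∷ xs) ≡ count v xs
  count-≢ xs v≢u = cong length (filter-reject (v ≟_) {xs = xs} v≢u)

  ∈⇒0<count : ∀ {xs} → v ∈ xs → 0 < count v xs
  ∈⇒0<count = filter-some (v ≟_)

  0<count⇒∈ : ∀ xs → 0 < count v xs → v ∈ xs
  0<count⇒∈ (x ∷ xs) 0< with v ≟ x
  ... | yes v≡x = here v≡x
  ... | no  _   = there (0<count⇒∈ xs 0<)

  count≡0⇒∉ : ∀ {xs} → count v xs ≡ 0 → v ∉ xs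
  count≡0⇒∉ eq v∈ = ℕ.<⇒≢ (∈⇒0<count v∈) (sym eq)

  odd-count-[_] : ∀ u → odd (count v [ u ]) ≡ does (v ≟ u)
  odd-count-[ u ] with v ≟ u
  ... | yes _ = refl
  ... | no  _ = refl

  odd-count-++ : ∀ xs ys → odd (count v (xs ++ ys)) ≡ odd (count v xs) xor odd (count v ys)
  odd-count-++ xs ys = trans (cong odd (count-++ xs ys)) (odd-+ (count v xs) _)

  odd-count-∷ʳ : ∀ xs u → odd (count v (xs ∷ʳ u)) ≡ odd (count v xs) xor does (v ≟ u)
  odd-count-∷ʳ xs u =
    trans (odd-count-++ xs [ u ]) (cong (odd (count v xs) xor_) odd-count-[ u ])

module _ {A : Set} where

  ++∷-disjoint : ∀ {x y : A} xs {ys} → Unique (xs ++ x ∷ ys) → y ∈ xs → y ≢ x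
  ++∷-disjoint (z ∷ zs) (z≢ ∷ _)  (here refl)  = All.lookup z≢ (∈-insert zs)
  ++∷-disjoint (z ∷ zs) (_ ∷ uniq) (there y∈) = ++∷-disjoint zs uniq y∈

  map-injective-on : ∀ {B : Set} (f : A → B) {xs x y} → Unique (map f xs) →
                     x ∈ xs → y ∈ xs → f x ≡ f y → x ≡ y
  map-injective-on f _          (here refl) (here refl) _  = refl
  map-injective-on f (x≢ ∷ _)   (here refl) (there y∈)  eq =
    contradiction eq (All.lookup x≢ (∈-map⁺ f y∈))
  map-injective-on f (x≢ ∷ _)   (there x∈)  (here refl) eq =
    contradiction (sym eq) (All.lookup x≢ (∈-map⁺ f x∈))
  map-injective-on f (_ ∷ uniq) (there x∈)  (there y∈)  eq =
    map-injective-on f uniq x∈ y∈ eq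

  split-at-two : ∀ {x y : A} {xs} → x ∈ xs → y ∈ xs → x ≢ y →
    (∃ λ as → ∃₂ λ bs cs → xs ≡ as ++ x ∷ bs ++ y ∷ cs) ⊎
    (∃ λ as → ∃₂ λ bs cs → xs ≡ as ++ y ∷ bs ++ x ∷ cs)
  split-at-two (here refl) (here refl) x≢y = contradiction refl x≢y
  split-at-two (here refl) (there y∈)  _ with bs , cs , refl ← ∈-∃++ y∈ = inj₁ ([] , bs , cs , refl)
  split-at-two (there x∈)  (here refl) _ with bs , cs , refl ← ∈-∃++ x∈ = inj₂ ([] , bs , cs , refl)
  split-at-two {xs = z ∷ _} (there x∈)  (there y∈)  x≢y with split-at-two x∈ y∈ x≢y
  ... | inj₁ (as , bs , cs , refl) = inj₁ (z ∷ as , bs , cs , refl)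
  ... | inj₂ (as , bs , cs , refl) = inj₂ (z ∷ as , bs , cs , refl)

  -- The second alternative is the wrap-around pair of a cyclic list cut open at its first entry.
  zip-successor : ∀ {x xs y} {s t : A} → (s , t) ∈ zip (x ∷ xs) (xs ∷ʳ y) →
    (∃₂ λ as bs → x ∷ xs ≡ as ++ s ∷ t ∷ bs) ⊎ (∃ λ as → x ∷ xs ≡ as ∷ʳ s × t ≡ y)
  zip-successor {x} {[]}     (here refl) = inj₂ ([] , refl , refl)
  zip-successor {x} {z ∷ xs} (here refl) = inj₁ ([] , xs , refl)
  zip-successor {x} {z ∷ xs} (there st∈) with zip-successor st∈
  ... | inj₁ (as , bs , eq) = inj₁ (x ∷ as , bs , cong (x ∷_) eq)
  ... | inj₂ (as , eq , t≡y) = inj₂ (x ∷ as , cong (x ∷_) eq , t≡y)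

  successor : ∀ {x xs y} {s : A} → s ∈ x ∷ xs → ∃ λ t → (s , t) ∈ zip (x ∷ xs) (xs ∷ʳ y)
  successor {xs = []}     (here refl) = _ , here refl
  successor {xs = z ∷ xs} (here refl) = _ , here refl
  successor {xs = z ∷ xs} (there s∈) with t , st∈ ← successor {xs = xs} s∈ = t , there st∈

  map-proj₂-zip : ∀ (x : A) xs y → map proj₂ (zip (x ∷ xs) (xs ∷ʳ y)) ≡ xs ∷ʳ y
  map-proj₂-zip x []       y = refl
  map-proj₂-zip x (z ∷ xs) y = cong (z ∷_) (map-proj₂-zip z xs y)

  zip-∈ : ∀ {s t : A} {xs ys} → (s , t) ∈ zip xs ys → s ∈ xs × t ∈ ys
  zip-∈ {xs = x ∷ xs} {y ∷ ys} (here refl) = here refl , here refl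
  zip-∈ {xs = x ∷ xs} {y ∷ ys} (there st∈) with s∈ , t∈ ← zip-∈ {xs = xs} st∈ = there s∈ , there t∈

  zip-predecessor-unique : ∀ {r s t : A} {xs ys} → Unique ys →
                           (r , t) ∈ zip xs ys → (s , t) ∈ zip xs ys → r ≡ s
  zip-predecessor-unique {xs = x ∷ xs} {y ∷ ys} _         (here refl) (here refl) = refl
  zip-predecessor-unique {xs = x ∷ xs} {y ∷ ys} (y≢ ∷ _)  (here refl) (there st∈) =
    contradiction refl (All.lookup y≢ (proj₂ (zip-∈ {xs = xs} st∈)))
  zip-predecessor-unique {xs = x ∷ xs} {y ∷ ys} (y≢ ∷ _)  (there rt∈) (here refl) =
    contradiction refl (All.lookup y≢ (proj₂ (zip-∈ {xs = xs} rt∈)))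
  zip-predecessor-unique {xs = x ∷ xs} {y ∷ ys} (_ ∷ uniq) (there rt∈) (there st∈) =
    zip-predecessor-unique uniq rt∈ st∈

  -- The leading `v` can be matched no earlier than the displayed `v`, so what follows it is matched
  -- inside `ys`.
  ∷-⊆-++∷⁻ : ∀ {v : A} {as} xs {ys} → v ∉ xs → v ∷ as ⊆ xs ++ v ∷ ys → as ⊆ ys
  ∷-⊆-++∷⁻ []       v∉ (_ ∷ˢ sub)   = Sublist.⊆-trans (_ ∷ˢ Sublist.⊆-refl) sub
  ∷-⊆-++∷⁻ []       v∉ (_ ∷ sub)    = sub
  ∷-⊆-++∷⁻ (x ∷ xs) v∉ (_ ∷ˢ sub)   = ∷-⊆-++∷⁻ xs (v∉ ∘ there) sub
  ∷-⊆-++∷⁻ (x ∷ xs) v∉ (refl ∷ sub) = contradiction (here refl) v∉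

  -- The two cases are that `w` is matched before the displayed `v`, or after it; it cannot be
  -- matched by that `v`.
  ∷∷-⊆-++∷⁻ : ∀ {w v : A} {as} xs {ys} → w ≢ v → v ∉ xs → w ∷ v ∷ as ⊆ xs ++ v ∷ ys →
              (w ∈ xs × as ⊆ ys) ⊎ (w ∷ v ∷ as ⊆ ys)
  ∷∷-⊆-++∷⁻ []       w≢v v∉ (_ ∷ˢ sub)   = inj₂ sub
  ∷∷-⊆-++∷⁻ []       w≢v v∉ (w≡v ∷ sub)  = contradiction w≡v w≢v
  ∷∷-⊆-++∷⁻ (x ∷ xs) w≢v v∉ (refl ∷ sub) = inj₁ (here refl , ∷-⊆-++∷⁻ xs (v∉ ∘ there) sub)
  ∷∷-⊆-++∷⁻ (x ∷ xs) w≢v v∉ (_ ∷ˢ sub) with ∷∷-⊆-++∷⁻ xs w≢v (v∉ ∘ there) sub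
  ... | inj₁ (w∈ , as⊆) = inj₁ (there w∈ , as⊆)
  ... | inj₂ sub′       = inj₂ sub′

-- Alternation of two vertices as a parity

module TwoOccurrences {n} (v : Fin n) (xs ys zs : List (Fin n)) where

  whole : List (Fin n)
  whole = xs ++ v ∷ ys ++ v ∷ zs

  private
    count-v : count v whole ≡ count v xs + suc (count v ys + suc (count v zs))
    count-v = begin
      count v whole                                  ≡⟨ count-++ xs _ ⟩
      count v xs + count v (v ∷ ys ++ v ∷ zs)        ≡⟨ cong (count v xs +_) (count-≡ (ys ++ v ∷ zs)) ⟩
      count v xs + suc (count v (ys ++ v ∷ zs))      ≡⟨ cong (λ k → count v xs + suc k) (count-++ ys _) ⟩
      count v xs + suc (count v ys + count v (v ∷ zs))
        ≡⟨ cong (λ k → count v xs + suc (count v ys + k)) (count-≡ zs) ⟩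
      count v xs + suc (count v ys + suc (count v zs)) ∎
      where open ≡-Reasoning

    no-others : ∀ {a b c} → a + suc (b + suc c) ≡ 2 → a ≡ 0 × b ≡ 0 × c ≡ 0
    no-others {a} {b} {c} eq
      rewrite ℕ.+-suc b c | ℕ.+-suc a (suc (b + c)) | ℕ.+-suc a (b + c)
      with abc≡0 ← ℕ.suc-injective (ℕ.suc-injective eq)
      with bc≡0 ← ℕ.m+n≡0⇒n≡0 a abc≡0 =
      ℕ.m+n≡0⇒m≡0 a abc≡0 , ℕ.m+n≡0⇒m≡0 b bc≡0 , ℕ.m+n≡0⇒n≡0 b bc≡0

  occurs-nowhere-else : count v whole ≡ 2 → count v xs ≡ 0 × count v ys ≡ 0 × count v zs ≡ 0
  occurs-nowhere-else v-twice =
    no-others {count v xs} {count v ys} (trans (sym count-v) v-twice)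

module Alternation {n} {v w : Fin n} (w≢v : w ≢ v) (xs ys zs : List (Fin n)) where
  open TwoOccurrences v xs ys zs

  Alternate : Set
  Alternate = (w ∷ v ∷ w ∷ v ∷ []) ⊆ whole ⊎ (v ∷ w ∷ v ∷ w ∷ []) ⊆ whole

  private
    count-w : count w whole ≡ count w xs + (count w ys + count w zs)
    count-w = begin
      count w whole                                  ≡⟨ count-++ xs _ ⟩
      count w xs + count w (v ∷ ys ++ v ∷ zs)        ≡⟨ cong (count w xs +_) (count-≢ (ys ++ v ∷ zs) w≢v) ⟩
      count w xs + count w (ys ++ v ∷ zs)            ≡⟨ cong (count w xs +_) (count-++ ys _) ⟩
      count w xs + (count w ys + count w (v ∷ zs))
        ≡⟨ cong (λ k → count w xs + (count w ys + k)) (count-≢ zs w≢v) ⟩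
      count w xs + (count w ys + count w zs) ∎
      where open ≡-Reasoning

    odd⇒outside : ∀ {a b c} → odd b ≡ true → a + (b + c) ≡ 2 → 0 < a ⊎ 0 < c
    odd⇒outside {suc _}             _ _    = inj₁ (s≤s z≤n)
    odd⇒outside {0} {1} {suc _}     _ _    = inj₂ (s≤s z≤n)
    odd⇒outside {0} {suc (suc (suc _))} _ ()

    outside⇒odd : ∀ {a b c} → 0 < b → 0 < a ⊎ 0 < c → a + (b + c) ≡ 2 → odd b ≡ true
    outside⇒odd {b = 1}               _ _               _  = refl
    outside⇒odd {0} {2} {suc _}       _ _               ()
    outside⇒odd {0} {suc (suc (suc _))} _ _             ()
    outside⇒odd {1} {suc (suc _)}     _ _               ()
    outside⇒odd {suc (suc a)} {suc (suc b)} _ _ eq =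
      contradiction (ℕ.suc-injective (ℕ.suc-injective eq)) (ℕ.m+1+n≢0 a)
    outside⇒odd {0} {2} {0} _ (inj₁ ())
    outside⇒odd {0} {2} {0} _ (inj₂ ())

    odd⇒positive : ∀ {b} → odd b ≡ true → 0 < b
    odd⇒positive {suc _} _ = s≤s z≤n

  -- An odd number out of two occurrences is one, so the other `w` lies outside the stretch between
  -- the two `v`. Before the first `v` it yields `w v w v`, after the second `v w v w`.
  odd⇒alternate : (w ∈ whole → count w whole ≡ 2) → odd (count w ys) ≡ true → Alternate
  odd⇒alternate twice odd-ys
    with w∈ys ← 0<count⇒∈ ys (odd⇒positive odd-ys)
    with odd⇒outside {count w xs} {count w ys} odd-ys
           (trans (sym count-w) (twice (∈-++⁺ʳ xs (there (∈-++⁺ˡ w∈ys)))))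
  ... | inj₁ 0<xs = inj₁ (++⁺ (from∈ (0<count⇒∈ xs 0<xs)) (refl ∷
                          ++⁺ (from∈ w∈ys)
                              (refl ∷ Sublist.minimum zs)))
  ... | inj₂ 0<zs = inj₂ (++⁺ (Sublist.minimum xs) (refl ∷
                          ++⁺ (from∈ w∈ys)
                              (refl ∷ from∈ (0<count⇒∈ zs 0<zs))))

  -- Since `v` occurs only at the two displayed places, either pattern forces one `w` between them
  -- and one outside, which uses up both occurrences of `w`.
  alternate⇒odd : count v whole ≡ 2 → (w ∈ whole → count w whole ≡ 2) →
                  Alternate → odd (count w ys) ≡ true
  alternate⇒odd v-twice w-twice alt
    with a≡0 , b≡0 , c≡0 ← occurs-nowhere-else v-twice =
    let w∈ys , w∈out = separated alt in
    outside⇒odd (∈⇒0<count w∈ys) w∈out (trans (sym count-w) (w-twice (∈-++⁺ʳ xs (there (∈-++⁺ˡ w∈ys)))))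
    where
    between : ∀ {as} → w ∷ v ∷ as ⊆ ys ++ v ∷ zs → w ∈ ys × as ⊆ zs
    between sub with ∷∷-⊆-++∷⁻ ys w≢v (count≡0⇒∉ b≡0) sub
    ... | inj₁ res  = res
    ... | inj₂ sub′ = contradiction
      (Sublist.lookup sub′ (there (here refl))) (count≡0⇒∉ c≡0)
    separated : Alternate → w ∈ ys × (0 < count w xs ⊎ 0 < count w zs)
    separated (inj₁ sub) with ∷∷-⊆-++∷⁻ xs w≢v (count≡0⇒∉ a≡0) sub
    ... | inj₁ (w∈xs , sub′) = proj₁ (between sub′) , inj₁ (∈⇒0<count w∈xs)
    ... | inj₂ sub′ with between sub′
    ...   | _ , wv⊆zs = contradiction (Sublist.lookup wv⊆zs (there (here refl))) (count≡0⇒∉ c≡0)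
    separated (inj₂ sub) with between (∷-⊆-++∷⁻ xs (count≡0⇒∉ a≡0) sub)
    ... | w∈ys , w⊆zs = w∈ys , inj₂ (∈⇒0<count (Sublist.lookup w⊆zs (here refl)))

-- Circuits and Euler circuits

module _ {n} (G : SimpleGraph n) (w v : Fin n) where

  private
    I = identityMatrix G
    A = adjacencyMatrix G

  IAS-φ : IAS G w (φ v) ≡ I w v
  IAS-φ = lookup-++ˡ (I w) _ v

  IAS-χ : IAS G w (χ v) ≡ A w v
  IAS-χ = trans (lookup-++ʳ (I w) _ (v ↑ˡ n)) (lookup-++ˡ (A w) _ v)

  IAS-ψ : IAS G w (ψ v) ≡ I w v xor A w v
  IAS-ψ = trans (lookup-++ʳ (I w) _ (n ↑ʳ v)) (lookup-++ʳ (A w) _ v)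

Unique-rotate : ∀ {A : Set} {x : A} {xs} → Unique (x ∷ xs) → Unique (xs ∷ʳ x)
Unique-rotate (x≢ ∷ uniq) = Unique.++⁺ uniq ([] ∷ [])
  λ { (x∈ , here refl) → All.lookup x≢ x∈ refl }

module _ (F : FourRegularGraph) where
  open FourRegularGraph F

  opposite-involutive : ∀ h → opposite (opposite h) ≡ h
  opposite-involutive (e , b) = cong (e ,_) (not-involutive b)

  opposite-irreflexive : ∀ {h} → opposite h ≢ h
  opposite-irreflexive {e , true}  ()
  opposite-irreflexive {e , false} ()

  same-edge : ∀ h t → edge h ≡ edge t → h ≡ t ⊎ h ≡ opposite t
  same-edge (e , true)  (_ , true)  refl = inj₁ refl
  same-edge (e , true)  (_ , false) refl = inj₂ refl
  same-edge (e , false) (_ , true)  refl = inj₂ refl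
  same-edge (e , false) (_ , false) refl = inj₁ refl

  Connected-sym : ∀ {v w} → Connected v w → Connected w v
  Connected-sym = reverse λ (h , s , t) →
    opposite h , t , trans (cong vertexOf (opposite-involutive h)) s

  step-Connected : ∀ h → Connected (source h) (target h)
  step-Connected h = (h , refl , refl) ◅ ε

  -- The half-edge by which a transition (s , t) enters its vertex is opposite s.
  transitions : Circuit F → List (HalfEdge × HalfEdge)
  transitions c = zip (steps c) (rest c ∷ʳ first c)
    where open Circuit

  module CircuitProperties (c : Circuit F) where
    open Circuit c

    rotated : steps ↭ rest ∷ʳ first
    rotated = ∷↭∷ʳ first rest

    steps-unique : Unique steps
    steps-unique = Unique.map⁻ simple

    rotated-unique : Unique (rest ∷ʳ first)
    rotated-unique = Unique-rotate steps-unique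

    edge-injective : ∀ {s t} → s ∈ steps → t ∈ steps → edge s ≡ edge t → s ≡ t
    edge-injective = map-injective-on edge simple

    linked-targets : ∀ {x xs y} → Linked (λ h h′ → target h ≡ source h′) (x ∷ xs ∷ʳ y) →
                     map target (x ∷ xs) ≡ map source (xs ∷ʳ y)
    linked-targets {xs = []}     (eq ∷ _)  = cong [_] eq
    linked-targets {xs = _ ∷ _}  (eq ∷ lk) = cong₂ _∷_ eq (linked-targets lk)

    zip-linked : ∀ {x xs y} → Linked (λ h h′ → target h ≡ source h′) (x ∷ xs ∷ʳ y) →
                 ∀ {s t} → (s , t) ∈ zip (x ∷ xs) (xs ∷ʳ y) → target s ≡ source t
    zip-linked {xs = []}    (eq ∷ _)  (here refl) = eq
    zip-linked {xs = _ ∷ _} (eq ∷ _)  (here refl) = eq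
    zip-linked {xs = _ ∷ _} (_ ∷ lk) (there st∈) = zip-linked lk st∈

    target≡source : ∀ {s t} → (s , t) ∈ transitions c → target s ≡ source t
    target≡source = zip-linked closed

    transition-steps : ∀ {s t} → (s , t) ∈ transitions c → s ∈ steps × t ∈ steps
    transition-steps st∈ with s∈ , t∈ ← zip-∈ {xs = steps} st∈ = s∈ , ∈-resp-↭ (↭-sym rotated) t∈

    -- Turning back would traverse one edge in both directions, against `simple`.
    transition-≢ : ∀ {s t} → (s , t) ∈ transitions c → opposite s ≢ t
    transition-≢ {s} st∈ refl with s∈ , t∈ ← transition-steps st∈
      with eq ← edge-injective s∈ t∈ refl = opposite-irreflexive {s} (sym eq)

    -- Along a closed walk the targets are the sources rotated by one place.
    count-targets : ∀ v → count v (map target steps) ≡ count v vertices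
    count-targets v = trans
      (cong (count v) (linked-targets closed))
      (↭-length (filter-↭ (v ≟_) (map⁺ source (↭-sym rotated))))

    steps-connected : ∀ {x xs} → Linked (λ h h′ → target h ≡ source h′) (x ∷ xs) →
                      ∀ {s} → s ∈ x ∷ xs → Connected (source x) (source s)
    steps-connected _         (here refl) = ε
    steps-connected {x} (eq ∷ lk) {s} (there s∈) =
      step-Connected x ◅◅ subst (λ u → Connected u (source s)) (sym eq) (steps-connected lk s∈)

    first-connected : ∀ {s} → s ∈ steps → Connected (source first) (source s)
    first-connected = steps-connected closed ∘ ∈-++⁺ˡ

  -- Visits and sides of an Euler circuit

  module EulerCircuit {v₀ : Vertex} (c : Circuit F)
                      (euler : EulerCircuitOfComponent F v₀ c) where
    open Circuit c
    open CircuitProperties c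

    private
      module Euler h = Equivalence (euler h)

    vertices-connected : ∀ {v} → v ∈ vertices → Connected v₀ v
    vertices-connected v∈ with s , s∈ , refl ← ∈-map⁻ source v∈ = Euler.to s (∈-map⁺ edge s∈)

    private
      -- An Euler circuit traverses each edge of its component once, so every half-edge of the
      -- component is listed here exactly once.
      halfEdges = steps ++ map opposite steps

      halfEdges-unique : Unique halfEdges
      halfEdges-unique = Unique.++⁺ steps-unique
        (Unique.map⁺ (λ {s} {t} eq → trans (sym (opposite-involutive s))
                                     (trans (cong opposite eq) (opposite-involutive t)))
                     steps-unique)
        λ {h} (h∈ , h∈opp) → disjoint h∈ (∈-map⁻ opposite h∈opp)
        where
        disjoint : ∀ {h} → h ∈ steps → ¬ (∃ λ t → t ∈ steps × h ≡ opposite t)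
        disjoint h∈ (t , t∈ , refl) =
          opposite-irreflexive {t} (edge-injective h∈ t∈ refl)

      ∈-halfEdges : ∀ {h} → Connected v₀ (vertexOf h) → h ∈ halfEdges
      ∈-halfEdges {h} conn with t , t∈ , eq ← ∈-map⁻ edge (Euler.from h conn)
        with same-edge h t eq
      ... | inj₁ refl = ∈-++⁺ˡ t∈
      ... | inj₂ refl = ∈-++⁺ʳ steps (∈-map⁺ opposite t∈)

      star : Vertex → List HalfEdge
      star v = map (proj₁ ∘ Inverse.to (regular v)) (allFin 4)

      star-unique : ∀ v → Unique (star v)
      star-unique v = Unique.map⁺
        (λ eq → Injection.injective (↔⇒↣ (regular v)) (proj₁-injective eq)) (Unique.allFin⁺ 4)
        where
        proj₁-injective : ∀ {x y : ∃ λ h → vertexOf h ≡ v} → proj₁ x ≡ proj₁ y → x ≡ y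
        proj₁-injective {h , p} {_ , q} refl = cong (h ,_) (Decidable⇒UIP.≡-irrelevant _≟_ p q)

      star-∈⇔ : ∀ v h → h ∈ star v ⇔ v ≡ vertexOf h
      star-∈⇔ v h = mk⇔ to from
        where
        to : h ∈ star v → v ≡ vertexOf h
        to h∈ with i , _ , refl ← ∈-map⁻ (proj₁ ∘ Inverse.to (regular v)) h∈ =
          sym (proj₂ (Inverse.to (regular v) i))
        from : v ≡ vertexOf h → h ∈ star v
        from eq = subst (_∈ star v) (cong proj₁ (Inverse.strictlyInverseˡ (regular v) (h , sym eq)))
                        (∈-map⁺ (proj₁ ∘ Inverse.to (regular v)) (∈-allFin _))

      count-map : ∀ (f : HalfEdge → Vertex) v xs →
                  count v (map f xs) ≡ length (filter (λ h → v ≟ f h) xs)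
      count-map f v []       = refl
      count-map f v (x ∷ xs) with v ≟ f x
      ... | yes _ = cong suc (count-map f v xs)
      ... | no  _ = count-map f v xs

      halves : ∀ {k} → k + k ≡ 4 → k ≡ 2
      halves {2} _ = refl
      halves {suc (suc (suc k))} eq rewrite ℕ.+-suc k (suc (suc k)) =
        contradiction (cong (λ m → m ∸ 4) eq) (ℕ.m+1+n≢0 k)

    -- The four half-edges at `v` divide into departures and arrivals, and a closed walk has equally
    -- many of both.
    visited-twice : ∀ {v} → v ∈ vertices → count v vertices ≡ 2
    visited-twice {v} v∈ = halves (begin
      count v vertices + count v vertices
        ≡⟨ cong (count v vertices +_) (count-targets v) ⟨
      count v vertices + count v (map target steps)
        ≡⟨ cong (λ us → count v vertices + count v us) (map-∘ steps) ⟩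
      count v vertices + count v (map vertexOf (map opposite steps))
        ≡⟨ count-++ {v = v} vertices _ ⟨
      count v (vertices ++ map vertexOf (map opposite steps))
        ≡⟨ cong (count v) (map-++ vertexOf steps _) ⟨
      count v (map vertexOf halfEdges)
        ≡⟨ count-map vertexOf v halfEdges ⟩
      length (filter (λ h → v ≟ vertexOf h) halfEdges)
        ≡⟨ ↭-length (∼bag⇒↭ (unique∧set⇒bag (Unique.filter⁺ (λ h → v ≟ vertexOf h) halfEdges-unique)
                                            (star-unique v) same-set)) ⟩
      length (star v) ≡⟨ refl ⟩
      4 ∎)
      where
      open ≡-Reasoning
      same-set : ∀ {h} → h ∈ filter (λ h → v ≟ vertexOf h) halfEdges ⇔ h ∈ star v
      same-set {h} = mk⇔
        (λ h∈ → Equivalence.from (star-∈⇔ v h)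
                  (proj₂ (∈-filter⁻ (λ h → v ≟ vertexOf h) {xs = halfEdges} h∈)))
        (λ h∈ → let v≡ = Equivalence.to (star-∈⇔ v h) h∈ in
          ∈-filter⁺ (λ h → v ≟ vertexOf h)
            (∈-halfEdges (subst (Connected v₀) v≡ (vertices-connected v∈))) v≡)

    -- The step traversing `e` is included, so a visit to `w` already switches `side w` on the edge
    -- by which the circuit leaves `w`.
    prefix : Edge → List HalfEdge → List HalfEdge
    prefix e []       = []
    prefix e (s ∷ ss) = if does (e ≟ edge s) then [ s ] else s ∷ prefix e ss

    prefix-split : ∀ as {s bs} → Unique (map edge (as ++ s ∷ bs)) →
                   prefix (edge s) (as ++ s ∷ bs) ≡ as ∷ʳ s
    prefix-split []       {s} _ rewrite dec-true (edge s ≟ edge s) refl = refl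
    prefix-split (a ∷ as) {s} (a≢ ∷ uniq)
      rewrite dec-false (edge s ≟ edge a)
                (λ eq → All.lookup a≢ (∈-map⁺ edge (∈-insert as)) (sym eq)) =
      cong (a ∷_) (prefix-split as uniq)

    -- The two passes of the Euler circuit through w cut it into two segments;
    -- side w tells them apart (and is constant when the circuit avoids w).
    side : Vertex → Edge → Bool
    side w e = odd (count w (map source (prefix e steps)))

    side-split : ∀ w as {s bs} → steps ≡ as ++ s ∷ bs →
                 side w (edge s) ≡ odd (count w (map source as)) xor does (w ≟ source s)
    side-split w as {s} eq = begin
      odd (count w (map source (prefix (edge s) steps)))
        ≡⟨ cong (λ ss → odd (count w (map source (prefix (edge s) ss)))) eq ⟩
      odd (count w (map source (prefix (edge s) (as ++ s ∷ _))))
        ≡⟨ cong (odd ∘ count w ∘ map source) (prefix-split as (subst (Unique ∘ map edge) eq simple)) ⟩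
      odd (count w (map source (as ∷ʳ s)))
        ≡⟨ cong (odd ∘ count w) (map-++ source as [ s ]) ⟩
      odd (count w (map source as ∷ʳ source s))
        ≡⟨ odd-count-∷ʳ (map source as) (source s) ⟩
      odd (count w (map source as)) xor does (w ≟ source s) ∎
      where open ≡-Reasoning

    -- This keeps `side` consistent across the starting point of the circuit.
    count-even : ∀ w → odd (count w vertices) ≡ false
    count-even w with 0 ℕ.<? count w vertices
    ... | yes 0<count = cong odd (visited-twice {w} (0<count⇒∈ vertices 0<count))
    ... | no  0≮count = cong odd (ℕ.n≤0⇒n≡0 (ℕ.≮⇒≥ 0≮count))

    side-transition : ∀ w {s t} → (s , t) ∈ transitions c →
                      side w (edge t) ≡ side w (edge s) xor does (w ≟ source t)
    side-transition w {s} {t} st∈ with zip-successor st∈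
    ... | inj₁ (as , bs , eq) = begin
      side w (edge t)
        ≡⟨ side-split w (as ∷ʳ s) (trans eq (sym (∷ʳ-++ as s (t ∷ bs)))) ⟩
      odd (count w (map source (as ∷ʳ s))) xor does (w ≟ source t)
        ≡⟨ cong (λ us → odd (count w us) xor does (w ≟ source t)) (map-++ source as [ s ]) ⟩
      odd (count w (map source as ∷ʳ source s)) xor does (w ≟ source t)
        ≡⟨ cong (_xor does (w ≟ source t)) (odd-count-∷ʳ (map source as) (source s)) ⟩
      (odd (count w (map source as)) xor does (w ≟ source s)) xor does (w ≟ source t)
        ≡⟨ cong (_xor does (w ≟ source t)) (side-split w as eq) ⟨
      side w (edge s) xor does (w ≟ source t) ∎
      where open ≡-Reasoning
    -- Wrap-around: the prefix of the last step is the whole circuit, of even parity, and that of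
    -- the first step is this step alone.
    ... | inj₂ (as , eq , refl) =
      trans (side-split w [] refl) (cong (_xor does (w ≟ source t)) (sym last-false))
      where
      open ≡-Reasoning
      last-false : side w (edge s) ≡ false
      last-false = begin
        side w (edge s) ≡⟨ side-split w as eq ⟩
        odd (count w (map source as)) xor does (w ≟ source s)
          ≡⟨ odd-count-∷ʳ (map source as) (source s) ⟨
        odd (count w (map source as ∷ʳ source s))
          ≡⟨ cong (odd ∘ count w) (map-++ source as [ s ]) ⟨
        odd (count w (map source (as ∷ʳ s)))
          ≡⟨ cong (odd ∘ count w ∘ map source) eq ⟨
        odd (count w vertices) ≡⟨ count-even w ⟩
        false ∎

    -- The prefix of `edge t` extends that of `edge s` by `bs` and `t`. As `t` also starts at
    -- `source s`, it accounts for the diagonal term.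
    side-passes : ∀ w as {s bs t cs} → steps ≡ as ++ s ∷ bs ++ t ∷ cs → source s ≡ source t →
                  side w (edge s) xor side w (edge t) ≡
                  does (w ≟ source s) xor odd (count w (map source bs))
    side-passes w as {s} {bs} {t} {cs} eq s≡t = begin
      side w (edge s) xor side w (edge t)
        ≡⟨ cong₂ _xor_ (side-split w as eq)
                       (side-split w (as ++ s ∷ bs) (trans eq (sym (++-assoc as (s ∷ bs) (t ∷ cs))))) ⟩
      (p as xor I) xor (p (as ++ s ∷ bs) xor does (w ≟ source t))
        ≡⟨ cong₂ (λ q u → (p as xor I) xor (q xor does (w ≟ u))) p-as∷bs (sym s≡t) ⟩
      (p as xor I) xor (((p as xor I) xor p bs) xor I)
        ≡⟨ cong ((p as xor I) xor_) (xor-assoc (p as xor I) (p bs) I) ⟩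
      (p as xor I) xor ((p as xor I) xor (p bs xor I))
        ≡⟨ xor-cancelˡ (p as xor I) (p bs xor I) ⟩
      p bs xor I
        ≡⟨ xor-comm (p bs) I ⟩
      I xor p bs ∎
      where
      open ≡-Reasoning
      p : List HalfEdge → Bool
      p ss = odd (count w (map source ss))
      I : Bool
      I = does (w ≟ source s)
      p-as∷bs : p (as ++ s ∷ bs) ≡ (p as xor I) xor p bs
      p-as∷bs = begin
        p (as ++ s ∷ bs)  ≡⟨ cong p (∷ʳ-++ as s bs) ⟨
        p (as ∷ʳ s ++ bs) ≡⟨ cong (odd ∘ count w) (map-++ source (as ∷ʳ s) bs) ⟩
        odd (count w (map source (as ∷ʳ s) ++ map source bs))
          ≡⟨ odd-count-++ (map source (as ∷ʳ s)) (map source bs) ⟩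
        p (as ∷ʳ s) xor p bs
          ≡⟨ cong (λ us → odd (count w us) xor p bs) (map-++ source as [ s ]) ⟩
        odd (count w (map source as ∷ʳ source s)) xor p bs
          ≡⟨ cong (_xor p bs) (odd-count-∷ʳ (map source as) (source s)) ⟩
        (p as xor I) xor p bs ∎

    -- The circuit leaves a vertex through h = s, or enters it through h just
    -- before the step s.
    Anchored : (h s : HalfEdge) (enters : Bool) → Set
    Anchored h s false = h ≡ s
    Anchored h s true  = (opposite h , s) ∈ transitions c

    -- Pass and direction determine the half-edge. Hence two distinct half-edges of the same pass
    -- have opposite directions.
    anchored-unique : ∀ {h k s} b → Anchored h s b → Anchored k s b → h ≡ k
    anchored-unique         false refl refl = refl
    anchored-unique {h} {k} true  hs∈  ks∈  = begin
      h                     ≡⟨ opposite-involutive h ⟨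
      opposite (opposite h) ≡⟨ cong opposite (zip-predecessor-unique rotated-unique hs∈ ks∈) ⟩
      opposite (opposite k) ≡⟨ opposite-involutive k ⟩
      k ∎
      where open ≡-Reasoning

    -- Reduces every half-edge to the departing step of its pass. An entering edge immediately
    -- precedes that step, so by `side-transition` its side is off by the identity column.
    anchor : ∀ {h} → Connected v₀ (vertexOf h) →
             ∃₂ λ s b → s ∈ steps × source s ≡ vertexOf h × Anchored h s b ×
                        ∀ w → side w (edge h) ≡ side w (edge s) xor (b ∧ does (w ≟ source s))
    anchor {h} conn with t , t∈ , eq ← ∈-map⁻ edge (Euler.from h conn) with same-edge h t eq
    ... | inj₁ refl = h , false , t∈ , refl , refl , λ w → sym (xor-identityʳ _)
    ... | inj₂ refl with s , ts∈ ← successor {xs = rest} t∈ =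
      s , true , proj₂ (transition-steps ts∈) , sym (target≡source ts∈)
        , subst (λ u → (u , s) ∈ transitions c) (sym (opposite-involutive t)) ts∈
        , λ w → sym (trans (cong (_xor does (w ≟ source s)) (side-transition w ts∈))
                    (trans (xor-assoc (side w (edge t)) _ _)
                    (trans (cong (side w (edge t) xor_) (xor-same (does (w ≟ source s))))
                           (xor-identityʳ _))))

-- Pairs of half-edges at a vertex as columns of `IAS`

module _ {F : FourRegularGraph} (C : EulerSystem F) where
  open FourRegularGraph F
  open EulerSystem C

  private
    G = interlacementGraph C
    M = IAS G

  private
    -- Only the owner of the column is remembered, because a transversal asks for one element per
    -- triple, whichever it is.
    Column : Vertex → (Vertex → Bool) → Set
    Column v d = ∃ λ x → owner x ≡ v × ∀ w → d w ≡ M w x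

    -- The case of a single pass: the departing steps agree, and only one of the two direction
    -- corrections survives.
    φ-column : ∀ {v d} b b′ → b ≢ b′ →
               (∀ w → d w ≡ (b ∧ does (w ≟ v)) xor (b′ ∧ does (w ≟ v))) → Column v d
    φ-column     true  true  b≢b′ _  = contradiction refl b≢b′
    φ-column     false false b≢b′ _  = contradiction refl b≢b′
    φ-column {v} false true  _    eq = φ v , owner-φ v , λ w → trans (eq w) (sym (IAS-φ G w v))
    φ-column {v} true  false _    eq = φ v , owner-φ v , λ w →
      trans (eq w) (trans (xor-identityʳ _) (sym (IAS-φ G w v)))

    -- The case of two passes. Equal directions cancel their corrections and leave `ψ`; opposite
    -- directions add the identity column, which turns `ψ` into `χ`.
    χψ-column : ∀ {v d} b b′ →
      (∀ w → d w ≡ (does (w ≟ v) xor adjacencyMatrix G w v) xor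
                   ((b ∧ does (w ≟ v)) xor (b′ ∧ does (w ≟ v)))) → Column v d
    χψ-column {v} false false eq = ψ v , owner-ψ v , λ w →
      trans (eq w) (trans (xor-identityʳ _) (sym (IAS-ψ G w v)))
    χψ-column {v} true  true  eq = ψ v , owner-ψ v , λ w →
      trans (eq w) (trans (cong ((does (w ≟ v) xor adjacencyMatrix G w v) xor_) (xor-same (does (w ≟ v))))
                   (trans (xor-identityʳ _) (sym (IAS-ψ G w v))))
    χψ-column {v} false true  eq = χ v , owner-χ v , λ w →
      trans (eq w) (trans (xor-cancel (does (w ≟ v)) (adjacencyMatrix G w v)) (sym (IAS-χ G w v)))
    χψ-column {v} true  false eq = χ v , owner-χ v , λ w →
      trans (eq w) (trans (cong ((does (w ≟ v) xor adjacencyMatrix G w v) xor_)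
                               (xor-identityʳ (does (w ≟ v))))
                   (trans (xor-cancel (does (w ≟ v)) (adjacencyMatrix G w v)) (sym (IAS-χ G w v))))

  module Transition {v₀ : Vertex} (i : Fin #circuits)
                    (euler : EulerCircuitOfComponent F v₀ (circuit i)) where
    open Circuit (circuit i)
    open CircuitProperties F (circuit i)
    open EulerCircuit F (circuit i) euler

    -- Interlacement may be witnessed on any circuit of the system. Two circuits through the
    -- component of `v` are both Euler circuits of it, and the system has just one.
    component-unique : ∀ {v j} → v ∈ Circuit.vertices (circuit j) → Connected v₀ v → i ≡ j
    component-unique {v} {j} v∈j conn = trans (sym (same i here-i)) (same j here-j)
      where
      same : ∀ k → EulerCircuitOfComponent F v (circuit k) → proj₁ (unique v) ≡ k
      same k = proj₂ (proj₂ (unique v))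
      re-base : ∀ {u k} → EulerCircuitOfComponent F u (circuit k) → Connected u v →
                EulerCircuitOfComponent F v (circuit k)
      re-base eul conn h = mk⇔
        (λ e∈ → Connected-sym F conn ◅◅ Equivalence.to (eul h) e∈)
        (λ v~h → Equivalence.from (eul h) (conn ◅◅ v~h))
      here-i : EulerCircuitOfComponent F v (circuit i)
      here-i = re-base euler conn
      here-j : EulerCircuitOfComponent F v (circuit j)
      here-j with u , eul ← eulerian j =
        re-base eul (EulerCircuit.vertices-connected F (circuit j) eul v∈j)

    module Passes as {s bs t cs} (split : steps ≡ as ++ s ∷ bs ++ t ∷ cs)
                  (s≡t : source s ≡ source t) where
      private
        v = source s
        open TwoOccurrences v (map source as) (map source bs) (map source cs)

        vertices-split : vertices ≡ whole
        vertices-split = begin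
          map source steps                     ≡⟨ cong (map source) split ⟩
          map source (as ++ s ∷ bs ++ t ∷ cs)  ≡⟨ map-++ source as _ ⟩
          map source as ++ v ∷ map source (bs ++ t ∷ cs)
            ≡⟨ cong (λ us → map source as ++ v ∷ us) (map-++ source bs _) ⟩
          map source as ++ v ∷ map source bs ++ source t ∷ map source cs
            ≡⟨ cong (λ u → map source as ++ v ∷ map source bs ++ u ∷ map source cs) s≡t ⟨
          whole ∎
          where open ≡-Reasoning

        twice : ∀ {w} → w ∈ whole → count w whole ≡ 2
        twice {w} w∈ = subst (λ us → count w us ≡ 2) vertices-split
                         (visited-twice (subst (w ∈_) (sym vertices-split) w∈))

        v∈whole : v ∈ whole
        v∈whole = ∈-insert (map source as)

        interlaced⇔odd : ∀ {w} → w ≢ v → Interlaced C w v ⇔ odd (count w (map source bs)) ≡ true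
        interlaced⇔odd {w} w≢v = mk⇔ to from
          where
          open Alternation w≢v (map source as) (map source bs) (map source cs)
            using (odd⇒alternate; alternate⇒odd)
          occurs : ∀ {c} → CyclicallyAlternate c w v → v ∈ Circuit.vertices c
          occurs (inj₁ sub) = Sublist.lookup sub (there (here refl))
          occurs (inj₂ sub) = Sublist.lookup sub (here refl)
          to : Interlaced C w v → odd (count w (map source bs)) ≡ true
          to (_ , j , alt)
            with refl ← component-unique (occurs {circuit j} alt)
                          (vertices-connected (subst (v ∈_) (sym vertices-split) v∈whole)) =
            alternate⇒odd (twice v∈whole) twice
              (subst (λ us → (w ∷ v ∷ w ∷ v ∷ []) ⊆ us ⊎ (v ∷ w ∷ v ∷ w ∷ []) ⊆ us) vertices-split alt)
          from : odd (count w (map source bs)) ≡ true → Interlaced C w v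
          from parity = w≢v , i ,
            subst (λ us → (w ∷ v ∷ w ∷ v ∷ []) ⊆ us ⊎ (v ∷ w ∷ v ∷ w ∷ []) ⊆ us)
                  (sym vertices-split) (odd⇒alternate twice parity)

      adjacency≡odd : ∀ w → adjacencyMatrix G w v ≡ odd (count w (map source bs))
      adjacency≡odd w = go (w ≟ v)
        where
        does-≟-true : ∀ b → does (b Bool.≟ true) ≡ b
        does-≟-true true  = refl
        does-≟-true false = refl
        go : Dec (w ≡ v) → adjacencyMatrix G w v ≡ odd (count w (map source bs))
        -- On the diagonal both sides vanish: no vertex is interlaced with itself, and `v` has no
        -- third visit between its two passes.
        go (yes refl) = trans (dec-false (interlaced? C v v) λ (v≢v , _) → v≢v refl)
                              (sym (cong odd (proj₁ (proj₂ (occurs-nowhere-else (twice v∈whole))))))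
        go (no w≢v)   = trans (does-⇔ (interlaced⇔odd w≢v) (interlaced? C w v) (_ Bool.≟ true))
                              (does-≟-true _)

    -- The right-hand side is the `w` entry of the column `ψ (source s)`.
    side-ψ : ∀ w {s t} → s ∈ steps → t ∈ steps → s ≢ t → source s ≡ source t →
             side w (edge s) xor side w (edge t) ≡ does (w ≟ source s) xor adjacencyMatrix G w (source s)
    side-ψ w {s} {t} s∈ t∈ s≢t s≡t with split-at-two s∈ t∈ s≢t
    ... | inj₁ (as , bs , cs , eq) = trans (side-passes w as eq s≡t)
      (cong (does (w ≟ source s) xor_) (sym (Passes.adjacency≡odd as eq s≡t w)))
    ... | inj₂ (as , bs , cs , eq) = begin
      side w (edge s) xor side w (edge t) ≡⟨ xor-comm (side w (edge s)) _ ⟩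
      side w (edge t) xor side w (edge s) ≡⟨ side-passes w as eq (sym s≡t) ⟩
      does (w ≟ source t) xor odd (count w (map source bs))
        ≡⟨ cong (does (w ≟ source t) xor_) (Passes.adjacency≡odd as eq (sym s≡t) w) ⟨
      does (w ≟ source t) xor adjacencyMatrix G w (source t)
        ≡⟨ cong (λ u → does (w ≟ u) xor adjacencyMatrix G w u) s≡t ⟨
      does (w ≟ source s) xor adjacencyMatrix G w (source s) ∎
      where open ≡-Reasoning

    _≟ʰ_ : (h k : HalfEdge) → Dec (h ≡ k)
    _≟ʰ_ = ≡-dec _≟_ Bool._≟_

    transition-column : ∀ {h k} → h ≢ k → Connected v₀ (vertexOf h) → vertexOf h ≡ vertexOf k →
                        Column (vertexOf h) (λ w → side w (edge h) xor side w (edge k))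
    transition-column {h} {k} h≢k conn h~k
      with s , b  , s∈ , s~h , h-anc , h-side ← anchor conn
      with t , b′ , t∈ , t~k , k-anc , k-side ← anchor (subst (Connected v₀) h~k conn) =
      subst (λ v → Column v (λ w → side w (edge h) xor side w (edge k))) s~h (column (s ≟ʰ t))
      where
      s~t : source s ≡ source t
      s~t = trans s~h (trans h~k (sym t~k))

      difference : ∀ w → side w (edge h) xor side w (edge k) ≡
        (side w (edge s) xor side w (edge t)) xor
        ((b ∧ does (w ≟ source s)) xor (b′ ∧ does (w ≟ source s)))
      difference w = begin
        side w (edge h) xor side w (edge k)
          ≡⟨ cong₂ _xor_ (h-side w) (k-side w) ⟩
        (side w (edge s) xor (b ∧ does (w ≟ source s))) xor
        (side w (edge t) xor (b′ ∧ does (w ≟ source t)))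
          ≡⟨ interchange (side w (edge s)) _ _ _ ⟩
        (side w (edge s) xor side w (edge t)) xor
        ((b ∧ does (w ≟ source s)) xor (b′ ∧ does (w ≟ source t)))
          ≡⟨ cong (λ u → (side w (edge s) xor side w (edge t)) xor
                         ((b ∧ does (w ≟ source s)) xor (b′ ∧ does (w ≟ u)))) s~t ⟨
        (side w (edge s) xor side w (edge t)) xor
        ((b ∧ does (w ≟ source s)) xor (b′ ∧ does (w ≟ source s))) ∎
        where open ≡-Reasoning

      column : Dec (s ≡ t) → Column (source s) (λ w → side w (edge h) xor side w (edge k))
      column (yes s≡t) = φ-column b b′ b≢b′ λ w → trans (difference w)
        (cong (_xor _) (trans (cong (λ r → side w (edge s) xor side w (edge r)) (sym s≡t))
                              (xor-same (side w (edge s)))))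
        where
        b≢b′ : b ≢ b′
        b≢b′ refl = h≢k (anchored-unique b h-anc (subst (λ r → Anchored k r b) (sym s≡t) k-anc))
      column (no s≢t) = χψ-column b b′ λ w →
        trans (difference w) (cong (_xor _) (side-ψ w s∈ t∈ s≢t s~t))

  columns : ∀ {A : Set} (f : A → Vertex) (d : A → Vertex → Bool) xs →
            (∀ {a} → a ∈ xs → Column (f a) (d a)) →
            ∃ λ ys → map owner ys ≡ map f xs ×
                     ∀ w → map (M w) ys ≡ map (λ a → d a w) xs
  columns f d []       col = [] , refl , λ _ → refl
  columns f d (x ∷ xs) col
    with y , y≡ , dy ← col (here refl)
    with ys , ys≡ , dys ← columns f d xs (col ∘ there) =
    y ∷ ys , cong₂ _∷_ y≡ ys≡ , λ w → cong₂ _∷_ (sym (dy w)) (dys w)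

  -- From a vertex-simple circuit to a transverse circuit

  module _ (γ : Circuit F) (vertices-unique : Unique (Circuit.vertices γ))
           {i : Fin #circuits}
           (euler : EulerCircuitOfComponent F (source (Circuit.first γ)) (circuit i)) where
    open Circuit γ
    open CircuitProperties F γ
    open EulerCircuit F (circuit i) euler using (side)

    private
      passing : HalfEdge × HalfEdge → Vertex → Bool
      passing (s , t) w = side w (edge s) xor side w (edge t)

      passing-column : ∀ {st} → st ∈ transitions F γ → Column (source (proj₂ st)) (passing st)
      passing-column {s , t} st∈ =
        -- The half-edges meeting at the vertex are `opposite s` and `t`; the former has the same
        -- edge as `s`, so the sum still telescopes over steps.
        subst (λ v → Column v (passing (s , t))) (target≡source st∈)
          (Transition.transition-column i euler (transition-≢ st∈)
            (subst (Connected _) (sym (target≡source st∈))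
                   (first-connected (proj₂ (transition-steps st∈))))
            (target≡source st∈))

    vertexSimple⇒transverseCircuit : ∃ λ S → TransverseCircuit G S × ∣ S ∣ ≤ size
    vertexSimple⇒transverseCircuit
      with columns (source ∘ proj₂) passing (transitions F γ) passing-column
    ... | xs , owners , sums = result xs (trans owners sources) λ w → trans
        (cong xorSum (sums w))
        (trans (xorSum-telescope (λ h → side w (edge h)) first rest first)
               (xor-same (side w (edge first))))
      where
      sources : map (source ∘ proj₂) (transitions F γ) ≡ map source rest ∷ʳ source first
      sources = trans (map-∘ (transitions F γ))
               (trans (cong (map source) (map-proj₂-zip first rest first)) (map-++ source rest _))
      result : ∀ xs → map owner xs ≡ map source rest ∷ʳ source first →
               (∀ w → xorSum (map (M w) xs) ≡ false) →
               ∃ λ S → TransverseCircuit G S × ∣ S ∣ ≤ size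
      result [] owners _
        with () ← trans (cong length owners)
                        (↭-length (↭-sym (∷↭∷ʳ (source first) (map source rest))))
      result (x ∷ xs) owners zeroSum
        -- Vertex-simplicity is used here: distinct owners give distinct columns as well as a
        -- transversal through them.
        with owners-unique ← subst Unique (sym owners) (Unique-rotate vertices-unique)
        with S , circ , S⊆xs , S≤ ← zeroSum⇒circuit M x xs (Unique.map⁻ owners-unique) zeroSum
        with T , transversal , xs⊆T ← transversal⊇ (x ∷ xs) owners-unique =
        S , (circ , T , transversal , λ j∈S → xs⊆T (S⊆xs j∈S)) , ℕ.≤-trans S≤ (ℕ.≤-reflexive (begin
          length (x ∷ xs)                         ≡⟨ length-map (owner {#vertices}) (x ∷ xs) ⟨
          length (map (owner {#vertices}) (x ∷ xs)) ≡⟨ cong length owners ⟩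
          length (map source rest ∷ʳ source first) ≡⟨ ↭-length (∷↭∷ʳ (source first) (map source rest)) ⟨
          length vertices                         ≡⟨ length-map source steps ⟩
          size ∎))
        where open ≡-Reasoning

-- Shortening a circuit until no vertex repeats

module _ {F : FourRegularGraph} where
  open FourRegularGraph F

  private
    Follows : HalfEdge → HalfEdge → Set
    Follows h h′ = target h ≡ source h′

  linked-++⁻ˡ : ∀ xs {ys} → Linked Follows (xs ++ ys) → Linked Follows xs
  linked-++⁻ˡ []           _           = []
  linked-++⁻ˡ (x ∷ [])     _           = [-]
  linked-++⁻ˡ (x ∷ y ∷ xs) (p ∷ linked) = p ∷ linked-++⁻ˡ (y ∷ xs) linked

  linked-close : ∀ xs {y z zs} → source z ≡ source y →
                 Linked Follows (xs ++ y ∷ zs) → Linked Follows (xs ∷ʳ z)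
  linked-close []           _  _            = [-]
  linked-close (x ∷ [])     eq (p ∷ _)      = trans p (sym eq) ∷ [-]
  linked-close (x ∷ w ∷ xs) eq (p ∷ linked) = p ∷ linked-close (w ∷ xs) eq linked

  Unique-++⁻ˡ : ∀ {A : Set} (xs : List A) {ys} → Unique (xs ++ ys) → Unique xs
  Unique-++⁻ˡ []       _           = []
  Unique-++⁻ˡ (x ∷ xs) (x≢ ∷ uniq) = All.++⁻ˡ xs x≢ ∷ Unique-++⁻ˡ xs uniq

  -- Induction from the end of the walk. If the tail has distinct sources and the source of `h`
  -- recurs at `k`, then the stretch from `h` up to `k` closes up and repeats no vertex.
  walk⇒vertexSimple : ∀ hs → Linked Follows hs → Unique (map edge hs) →
    Unique (map source hs) ⊎
    ∃ λ (γ : Circuit F) → Unique (Circuit.vertices γ) × Circuit.size γ ≤ length hs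
  walk⇒vertexSimple []       _      _ = inj₁ []
  walk⇒vertexSimple (h ∷ hs) linked (h≢ ∷ simple)
    with walk⇒vertexSimple hs (tail linked) simple
  ... | inj₂ (γ , uniq , size≤) = inj₂ (γ , uniq , ℕ.m≤n⇒m≤1+n size≤)
  ... | inj₁ uniq with _∈?_ _≟_ (source h) (map source hs)
  ...   | no  h∉ = inj₁ (All.¬Any⇒All¬ _ h∉ ∷ uniq)
  ...   | yes h∈
    with k , k∈ , h≡k ← ∈-map⁻ source h∈
    with as , bs , refl ← ∈-∃++ k∈ = inj₂ (γ , γ-unique , size≤)
    where
    γ : Circuit F
    γ = record
      { first  = h
      ; rest   = as
      ; closed = linked-close (h ∷ as) h≡k linked
      ; simple = Unique-++⁻ˡ (map edge (h ∷ as))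
                   (subst Unique (cong (edge h ∷_) (map-++ edge as (k ∷ bs))) (h≢ ∷ simple))
      }
    as-unique : Unique (map source as ++ source k ∷ map source bs)
    as-unique = subst Unique (map-++ source as (k ∷ bs)) uniq
    γ-unique : Unique (source h ∷ map source as)
    γ-unique = All.tabulate (λ u∈ h≡u → ++∷-disjoint (map source as) as-unique u∈
                                          (trans (sym h≡u) h≡k))
             ∷ Unique-++⁻ˡ (map source as) as-unique
    size≤ : length (h ∷ as) ≤ length (h ∷ as ++ k ∷ bs)
    size≤ = ℕ.≤-trans (ℕ.m≤m+n _ _) (ℕ.≤-reflexive (sym (length-++ (h ∷ as))))

  circuit⇒vertexSimple : (γ : Circuit F) →
    ∃ λ (γ′ : Circuit F) → Unique (Circuit.vertices γ′) × Circuit.size γ′ ≤ Circuit.size γ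
  circuit⇒vertexSimple γ
    with walk⇒vertexSimple (Circuit.steps γ) (linked-++⁻ˡ _ (Circuit.closed γ)) (Circuit.simple γ)
  ... | inj₁ uniq = γ , uniq , ℕ.≤-refl
  ... | inj₂ res  = res

theorem5 : (F : FourRegularGraph) (C : EulerSystem F) (k : ℕ) → .{{_ : NonZero k}} →
    (∃ λ (γ : Circuit F) → Circuit.size γ ≡ k) →
    ∃ λ S → TransverseCircuit (interlacementGraph C) S × ∣ S ∣ ≤ k
theorem5 F C k (γ , refl)
  with γ′ , uniq , γ′≤γ ← circuit⇒vertexSimple γ
  -- One Euler circuit suffices, since the whole of `γ′` stays in the component of its first vertex.
  with i , euler , _ ← EulerSystem.unique C (FourRegularGraph.source F (Circuit.first γ′))
  with S , circ , S≤γ′ ← vertexSimple⇒transverseCircuit C γ′ uniq euler =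
  S , circ , ℕ.≤-trans S≤γ′ γ′≤γ
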